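{- Let $K$ be a definably complete expansion of an ordered field, let $m,n\ge 1$, and let $D\subseteq K^{m+n}$ be a (not necessarily definable) subset. For $x\in K^m$ put $D_x:=\{y\in K^n : (x,y)\in D\}$, and let $T:=\{x\in K^m : D_x \text{ is definably meager in } K^n\}$. If $D$ is definably meager in $K^{m+n}$, then $T$ is definably residual in $K^m$.
   Context: "Definable" means definable in the first-order structure $K$ with parameters from $K$. $K$ carries the order topology, $K^n$ the product topology. An expansion $K$ of an ordered field is definably complete if every definable subset of $K$ has a supremum in $K\cup\{\pm\infty\}$. Let $X\subseteq Y\subseteq K^n$ with $Y$ definable. $X$ is nowhere dense in $Y$ if the closure of $X$ in $Y$ has empty interior in $Y$. $X$ is definably meager in $Y$ if there is a definable family $(A(t))_{t\in K}$ of nowhere dense subsets of $Y$, increasing in $t$ (i.e. $A(t)\subseteq A(t')$ for $t\le t'$), with $X\subseteq\bigcup_{t\in K}A(t)$ ($X$ itself need not be definable). $X$ is definably residual in $Y$ if $Y\setminus X$ is definably meager in $Y$. -}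

module Defs where

open import Level using (Level; _⊔_; suc; Setω)
open import Algebra.Structures using (IsCommutativeRing)
open import Axiom.ExcludedMiddle using (ExcludedMiddle)
open import Data.Empty.Polymorphic using (⊥)
open import Data.Fin.Base using (Fin)
open import Data.Nat.Base as ℕ using (ℕ)
open import Data.Product.Base using (∃; ∃₂; _×_)
open import Data.Sum.Base using (_⊎_)
open import Data.Vec.Base using (Vec; []; _∷_; _++_; lookup; tabulate)
open import Data.Vec.Relation.Binary.Pointwise.Inductive using (Pointwise)
open import Relation.Binary.Core using (Rel)
open import Relation.Binary.Structures using (IsStrictTotalOrder)
open import Relation.Binary.PropositionalEquality.Core using (_≡_; _≢_)
open import Relation.Nullary.Construct.Add.Extrema using (_±; [_])
open import Relation.Unary using (Pred; _∈_; _⊆_; _∩_; _∖_; Empty)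
import Relation.Binary.Construct.Add.Extrema.NonStrict as AddExtrema
import Relation.Binary.Construct.StrictToNonStrict as ToNonStrict

-- The metatheory is classical: excluded middle, as an explicit hypothesis.
Classical : Setω
Classical = ∀ {a} → ExcludedMiddle a

record OrderedField c ℓ : Set (suc (c ⊔ ℓ)) where
  infix  4 _<_
  infixl 6 _+_
  infixl 7 _*_
  infix  8 -_
  field
    Carrier            : Set c
    _<_                : Rel Carrier ℓ
    _+_ _*_            : Carrier → Carrier → Carrier
    -_                 : Carrier → Carrier
    0# 1#              : Carrier
    isCommutativeRing  : IsCommutativeRing _≡_ _+_ _*_ -_ 0# 1#
    0≢1                : 0# ≢ 1#
    inverse            : ∀ x → x ≢ 0# → ∃ λ y → x * y ≡ 1#
    isStrictTotalOrder : IsStrictTotalOrder _≡_ _<_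
    +-monoˡ-<          : ∀ z {x y} → x < y → x + z < y + z
    *-positive         : ∀ {x y} → 0# < x → 0# < y → 0# < x * y

  -- x ≤ y  =  x < y ⊎ x ≡ y
  open ToNonStrict _≡_ _<_ public using (_≤_)

-- The symbols of a first-order language other than those of ordered rings.
record Signature f r : Set (suc (f ⊔ r)) where
  field
    FunSym   : Set f
    funArity : FunSym → ℕ
    RelSym   : Set r
    relArity : RelSym → ℕ

record Expansion c ℓ f r : Set (suc (c ⊔ ℓ ⊔ f ⊔ r)) where
  field
    orderedField : OrderedField c ℓ
    signature    : Signature f r
  open OrderedField orderedField public
  open Signature signature public
  field
    ⟦_⟧ᶠ : (g : FunSym) → Vec Carrier (funArity g) → Carrier
    ⟦_⟧ʳ : (R : RelSym) → Pred (Vec Carrier (relArity R)) ℓ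

-- First-order formulas over the full language, with every element of K
-- available as a constant: these are the formulas with parameters from K.
module _ {c ℓ f r} (K : Expansion c ℓ f r) where
  open Expansion K

  data Term (n : ℕ) : Set (c ⊔ f) where
    var     : Fin n → Term n
    const   : Carrier → Term n
    _⊕_ _⊗_ : Term n → Term n → Term n
    ⊖_      : Term n → Term n
    fun     : (g : FunSym) → (Fin (funArity g) → Term n) → Term n

  data Formula (n : ℕ) : Set (c ⊔ f ⊔ r) where
    _≈̇_ _<̇_     : Term n → Term n → Formula n
    rel          : (R : RelSym) → (Fin (relArity R) → Term n) → Formula n
    ⊥̇            : Formula n
    _∧̇_ _∨̇_ _⇒̇_ : Formula n → Formula n → Formula n
    -- the bound variable gets index 0
    ∀̇_ ∃̇_        : Formula (ℕ.suc n) → Formula n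

module _ {c ℓ f r} {K : Expansion c ℓ f r} where
  open Expansion K

  eval : ∀ {n} → Term K n → Vec Carrier n → Carrier
  eval (var i)    x = lookup x i
  eval (const a)  x = a
  eval (s ⊕ t)    x = eval s x + eval t x
  eval (s ⊗ t)    x = eval s x * eval t x
  eval (⊖ t)      x = - eval t x
  eval (fun g ts) x = ⟦ g ⟧ᶠ (tabulate λ i → eval (ts i) x)

  -- The subset of Kⁿ defined by a formula; the definable subsets of Kⁿ are
  -- exactly the sets ⟦ φ ⟧.
  ⟦_⟧ : ∀ {n} → Formula K n → Pred (Vec Carrier n) (c ⊔ ℓ)
  ⟦ s ≈̇ t ⟧    x = Level.Lift (c ⊔ ℓ) (eval s x ≡ eval t x)
  ⟦ s <̇ t ⟧    x = Level.Lift (c ⊔ ℓ) (eval s x < eval t x)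
  ⟦ rel R ts ⟧ x = Level.Lift (c ⊔ ℓ) (⟦ R ⟧ʳ (tabulate λ i → eval (ts i) x))
  ⟦ ⊥̇ ⟧        x = ⊥
  ⟦ φ ∧̇ ψ ⟧    x = ⟦ φ ⟧ x × ⟦ ψ ⟧ x
  ⟦ φ ∨̇ ψ ⟧    x = ⟦ φ ⟧ x ⊎ ⟦ ψ ⟧ x
  ⟦ φ ⇒̇ ψ ⟧    x = ⟦ φ ⟧ x → ⟦ ψ ⟧ x
  ⟦ ∀̇ φ ⟧      x = ∀ a → ⟦ φ ⟧ (a ∷ x)
  ⟦ ∃̇ φ ⟧      x = ∃ λ a → ⟦ φ ⟧ (a ∷ x)

module _ {c ℓ f r} (K : Expansion c ℓ f r) where
  open Expansion K
  open AddExtrema _≤_ using (_≤±_)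

  -- Least upper bound in K ∪ {±∞}.
  IsSupremum : ∀ {p} → Pred Carrier p → Carrier ± → Set (c ⊔ ℓ ⊔ p)
  IsSupremum X s = UpperBound s × (∀ u → UpperBound u → s ≤± u)
    where
    UpperBound : Carrier ± → Set _
    UpperBound u = ∀ x → x ∈ X → [ x ] ≤± u

  DefinablyComplete : Set (c ⊔ ℓ ⊔ f ⊔ r)
  DefinablyComplete =
    (φ : Formula K 1) → ∃ (IsSupremum λ a → (a ∷ []) ∈ ⟦ φ ⟧)

  -- Open boxes.  K has no endpoints, so open intervals (a , b) form a base of
  -- the order topology and open boxes form a base of the product topology.
  Box : ∀ {n} → Vec Carrier n → Vec Carrier n → Pred (Vec Carrier n) (c ⊔ ℓ)
  Box a b x = Pointwise _<_ a x × Pointwise _<_ x b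

  -- Meagerness is only meant for definable Y; Y = Kⁿ is U.
  module _ {n y} (Y : Pred (Vec Carrier n) y) where

    -- Closure and interior for the subspace topology on Y.
    ClosureIn : ∀ {p} → Pred (Vec Carrier n) p → Pred (Vec Carrier n) (c ⊔ ℓ ⊔ y ⊔ p)
    ClosureIn X z = z ∈ Y × (∀ a b → z ∈ Box a b → ∃ λ x → x ∈ Box a b × x ∈ Y × x ∈ X)

    InteriorIn : ∀ {p} → Pred (Vec Carrier n) p → Pred (Vec Carrier n) (c ⊔ ℓ ⊔ y ⊔ p)
    InteriorIn X z = z ∈ Y × (∃₂ λ a b → z ∈ Box a b × (Box a b ∩ Y ⊆ X))

    NowhereDenseIn : ∀ {p} → Pred (Vec Carrier n) p → Set (c ⊔ ℓ ⊔ y ⊔ p)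
    NowhereDenseIn X = Empty (InteriorIn (ClosureIn X))

    -- The definable family is A(t) = { x | (t , x) ∈ ⟦ φ ⟧ }.
    DefinablyMeagerIn : ∀ {p} → Pred (Vec Carrier n) p → Set (c ⊔ ℓ ⊔ f ⊔ r ⊔ y ⊔ p)
    DefinablyMeagerIn X = ∃ λ (φ : Formula K (ℕ.suc n)) →
      let A : Carrier → Pred (Vec Carrier n) (c ⊔ ℓ)
          A t x = (t ∷ x) ∈ ⟦ φ ⟧
      in (∀ t → A t ⊆ Y × NowhereDenseIn (A t))
       × (∀ {t t′} → t ≤ t′ → A t ⊆ A t′)
       × (∀ {x} → x ∈ X → ∃ λ t → x ∈ A t)

    DefinablyResidualIn : ∀ {p} → Pred (Vec Carrier n) p → Set (c ⊔ ℓ ⊔ f ⊔ r ⊔ y ⊔ p)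
    DefinablyResidualIn X = DefinablyMeagerIn (Y ∖ X)

Fibre : ∀ {a d} {A : Set a} {m n} → Pred (Vec A (m ℕ.+ n)) d → Vec A m → Pred (Vec A n) d
Fibre D x y = (x ++ y) ∈ D

{-# OPTIONS --safe #-}
module Submission where

-- Let D ⊆ ⋃ A(t) with A(t) ⊆ Kᵐ⁺ⁿ nowhere dense and increasing in t.  If D_x is
-- not meager then the closure of some A(t)_x contains a box, and after enlarging
-- t that box may be taken of radius at least 1/t with centre in [-t , t]ⁿ.  Call
-- the set of these x Fat(t).  It is nowhere dense by a pigeonhole principle that
-- replaces the countable base of the classical Kuratowski–Ulam argument: were it
-- somewhere dense, then for somewhere densely many x the centre could be chosen
-- in a fixed box c + [0 , 1/t)ⁿ, so c + (0 , 1/t)ⁿ lies in the closure of A(t)_x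
-- for all those x, and A(t) would be somewhere dense.  The pigeonhole is applied
-- one coordinate at a time: if s + ε stayed in { s : the x admitting a centre
-- coordinate < s are nowhere dense } for every s in it, this bounded definable
-- set would have no supremum.

open import Defs
open import Level using (Level; _⊔_; lift; lower)
open import Axiom.DoubleNegationElimination using (em⇒dne)
open import Algebra.Bundles using (Ring)
open import Algebra.Structures using (IsCommutativeRing)
import Algebra.Properties.Ring as RingProperties
open import Data.Empty using (⊥-elim)
open import Data.Fin.Base using (Fin; zero; suc; _↑ˡ_; _↑ʳ_)
open import Data.Nat.Base as ℕ using (ℕ; zero; suc)
open import Data.Product.Base using (∃; ∃₂; _×_; _,_; proj₁; proj₂; uncurry)
open import Data.Product.Function.NonDependent.Propositional using (_×-⇔_)
open import Data.Sum.Base as Sum using (_⊎_; inj₁; inj₂; [_,_]′)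
open import Data.Sum.Function.Propositional using (_⊎-⇔_)
open import Data.Unit.Base using (tt)
open import Data.Vec.Base as Vec using (Vec; []; _∷_; _++_; lookup; take; drop; head; tail; splitAt)
import Data.Vec.Properties as Vec
open import Data.Vec.Relation.Binary.Pointwise.Inductive as Pointwise using (Pointwise; []; _∷_)
open import Data.Vec.Relation.Unary.All as All using (All; []; _∷_)
open import Function.Base using (_∘_; id; case_of_)
open import Function.Bundles using (_⇔_; mk⇔; Equivalence)
open import Function.Construct.Composition using (_⇔-∘_)
open import Function.Related.TypeIsomorphisms using (→-cong-⇔)
open import Relation.Binary.Definitions using (tri<; tri≈; tri>)
open import Relation.Binary.PropositionalEquality
  using (_≡_; refl; sym; trans; cong; cong₂; subst; subst₂; module ≡-Reasoning)
open import Relation.Binary.Structures using (IsStrictTotalOrder)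
import Relation.Binary.Construct.Add.Extrema.NonStrict as AddExtrema
import Relation.Binary.Construct.Add.Supremum.NonStrict as AddSupremum
import Relation.Binary.Construct.StrictToNonStrict as ToNonStrict
open import Relation.Nullary.Construct.Add.Extrema using (⊥±; ⊤±; [_])
open import Relation.Nullary using (¬_; yes; no)
open import Relation.Unary using (Pred; U; _∪_; _⊆_)

open Equivalence using (to; from)

private
  variable
    j k n : ℕ
    p q : Level

-- Taking and dropping on concatenated vectors.

take-++ : ∀ {a} {A : Set a} (xs : Vec A k) (ys : Vec A n) → take k (xs ++ ys) ≡ xs
take-++ []       ys = refl
take-++ (x ∷ xs) ys = cong (x ∷_) (take-++ xs ys)

drop-++ : ∀ {a} {A : Set a} (xs : Vec A k) (ys : Vec A n) → drop k (xs ++ ys) ≡ ys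
drop-++ []       ys = refl
drop-++ (x ∷ xs) ys = drop-++ xs ys

lookup-take : ∀ {a} {A : Set a} k (xs : Vec A (k ℕ.+ n)) i → lookup (take k xs) i ≡ lookup xs (i ↑ˡ n)
lookup-take (suc k) (x ∷ xs) zero    = refl
lookup-take (suc k) (x ∷ xs) (suc i) = lookup-take k xs i

lookup-drop : ∀ {a} {A : Set a} k (xs : Vec A (k ℕ.+ n)) i → lookup (drop k xs) i ≡ lookup xs (k ↑ʳ i)
lookup-drop zero    xs       i = refl
lookup-drop (suc k) (x ∷ xs) i = lookup-drop k xs i

-- Substitution in formulas and a calculus of definable predicates.

module Definability {c ℓ f r} (K : Expansion c ℓ f r) where
  open Expansion K

  renameᵗ : (Fin n → Fin k) → Term K n → Term K k
  renameᵗ ρ (var i)    = var (ρ i)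
  renameᵗ ρ (const a)  = const a
  renameᵗ ρ (s ⊕ t)    = renameᵗ ρ s ⊕ renameᵗ ρ t
  renameᵗ ρ (s ⊗ t)    = renameᵗ ρ s ⊗ renameᵗ ρ t
  renameᵗ ρ (⊖ t)      = ⊖ renameᵗ ρ t
  renameᵗ ρ (fun g ts) = fun g (λ i → renameᵗ ρ (ts i))

  substᵗ : (Fin n → Term K k) → Term K n → Term K k
  substᵗ σ (var i)    = σ i
  substᵗ σ (const a)  = const a
  substᵗ σ (s ⊕ t)    = substᵗ σ s ⊕ substᵗ σ t
  substᵗ σ (s ⊗ t)    = substᵗ σ s ⊗ substᵗ σ t
  substᵗ σ (⊖ t)      = ⊖ substᵗ σ t
  substᵗ σ (fun g ts) = fun g (λ i → substᵗ σ (ts i))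

  lift-subst : (Fin n → Term K k) → Fin (suc n) → Term K (suc k)
  lift-subst σ zero    = var zero
  lift-subst σ (suc i) = renameᵗ suc (σ i)

  substᶠ : (Fin n → Term K k) → Formula K n → Formula K k
  substᶠ σ (s ≈̇ t)    = substᵗ σ s ≈̇ substᵗ σ t
  substᶠ σ (s <̇ t)    = substᵗ σ s <̇ substᵗ σ t
  substᶠ σ (rel R ts) = rel R (λ i → substᵗ σ (ts i))
  substᶠ σ ⊥̇          = ⊥̇
  substᶠ σ (φ ∧̇ ψ)    = substᶠ σ φ ∧̇ substᶠ σ ψ
  substᶠ σ (φ ∨̇ ψ)    = substᶠ σ φ ∨̇ substᶠ σ ψ
  substᶠ σ (φ ⇒̇ ψ)    = substᶠ σ φ ⇒̇ substᶠ σ ψ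
  substᶠ σ (∀̇ φ)      = ∀̇ substᶠ (lift-subst σ) φ
  substᶠ σ (∃̇ φ)      = ∃̇ substᶠ (lift-subst σ) φ

  eval-renameᵗ : (ρ : Fin n → Fin k) {v : Vec Carrier k} {w : Vec Carrier n} →
                 (∀ i → lookup v (ρ i) ≡ lookup w i) →
                 ∀ t → eval (renameᵗ ρ t) v ≡ eval t w
  eval-renameᵗ ρ e (var i)    = e i
  eval-renameᵗ ρ e (const a)  = refl
  eval-renameᵗ ρ e (s ⊕ t)    = cong₂ _+_ (eval-renameᵗ ρ e s) (eval-renameᵗ ρ e t)
  eval-renameᵗ ρ e (s ⊗ t)    = cong₂ _*_ (eval-renameᵗ ρ e s) (eval-renameᵗ ρ e t)
  eval-renameᵗ ρ e (⊖ t)      = cong -_ (eval-renameᵗ ρ e t)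
  eval-renameᵗ ρ e (fun g ts) = cong ⟦ g ⟧ᶠ (Vec.tabulate-cong λ i → eval-renameᵗ ρ e (ts i))

  eval-substᵗ : (σ : Fin n → Term K k) {v : Vec Carrier k} {w : Vec Carrier n} →
                (∀ i → eval (σ i) v ≡ lookup w i) →
                ∀ t → eval (substᵗ σ t) v ≡ eval t w
  eval-substᵗ σ e (var i)    = e i
  eval-substᵗ σ e (const a)  = refl
  eval-substᵗ σ e (s ⊕ t)    = cong₂ _+_ (eval-substᵗ σ e s) (eval-substᵗ σ e t)
  eval-substᵗ σ e (s ⊗ t)    = cong₂ _*_ (eval-substᵗ σ e s) (eval-substᵗ σ e t)
  eval-substᵗ σ e (⊖ t)      = cong -_ (eval-substᵗ σ e t)
  eval-substᵗ σ e (fun g ts) = cong ⟦ g ⟧ᶠ (Vec.tabulate-cong λ i → eval-substᵗ σ e (ts i))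

  eval-lift-subst : (σ : Fin n → Term K k) {v : Vec Carrier k} {w : Vec Carrier n} →
                    (∀ i → eval (σ i) v ≡ lookup w i) →
                    ∀ a i → eval (lift-subst σ i) (a ∷ v) ≡ lookup (a ∷ w) i
  eval-lift-subst σ e a zero    = refl
  eval-lift-subst σ e a (suc i) = trans (eval-renameᵗ suc (λ _ → refl) (σ i)) (e i)

  ≡⇒⇔ : {A B : Set p} → A ≡ B → A ⇔ B
  ≡⇒⇔ refl = mk⇔ id id

  ∀-⇔ : ∀ {a} {A : Set a} {P : A → Set p} {Q : A → Set q} →
        (∀ x → P x ⇔ Q x) → (∀ x → P x) ⇔ (∀ x → Q x)
  ∀-⇔ e = mk⇔ (λ h x → to (e x) (h x)) (λ h x → from (e x) (h x))

  ∃-⇔ : ∀ {a} {A : Set a} {P : A → Set p} {Q : A → Set q} →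
        (∀ x → P x ⇔ Q x) → ∃ P ⇔ ∃ Q
  ∃-⇔ e = mk⇔ (λ (x , h) → x , to (e x) h) (λ (x , h) → x , from (e x) h)

  -- Relating `v` and `w` entry by entry gives a hypothesis that extends under a quantifier, by
  -- `eval-lift-subst`.
  ⟦substᶠ⟧ : (σ : Fin n → Term K k) {v : Vec Carrier k} {w : Vec Carrier n} →
             (∀ i → eval (σ i) v ≡ lookup w i) →
             ∀ φ → ⟦ substᶠ σ φ ⟧ v ⇔ ⟦ φ ⟧ w
  ⟦substᶠ⟧ σ e (s ≈̇ t)    =
    ≡⇒⇔ (cong₂ (λ a b → Level.Lift _ (a ≡ b)) (eval-substᵗ σ e s) (eval-substᵗ σ e t))
  ⟦substᶠ⟧ σ e (s <̇ t)    =
    ≡⇒⇔ (cong₂ (λ a b → Level.Lift _ (a < b)) (eval-substᵗ σ e s) (eval-substᵗ σ e t))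
  ⟦substᶠ⟧ σ e (rel R ts) =
    ≡⇒⇔ (cong (λ a → Level.Lift _ (⟦ R ⟧ʳ a)) (Vec.tabulate-cong λ i → eval-substᵗ σ e (ts i)))
  ⟦substᶠ⟧ σ e ⊥̇          = mk⇔ id id
  ⟦substᶠ⟧ σ e (φ ∧̇ ψ)    = ⟦substᶠ⟧ σ e φ ×-⇔ ⟦substᶠ⟧ σ e ψ
  ⟦substᶠ⟧ σ e (φ ∨̇ ψ)    = ⟦substᶠ⟧ σ e φ ⊎-⇔ ⟦substᶠ⟧ σ e ψ
  ⟦substᶠ⟧ σ e (φ ⇒̇ ψ)    = →-cong-⇔ (⟦substᶠ⟧ σ e φ) (⟦substᶠ⟧ σ e ψ)
  ⟦substᶠ⟧ σ e (∀̇ φ)      = ∀-⇔ λ a → ⟦substᶠ⟧ (lift-subst σ) (eval-lift-subst σ e a) φ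
  ⟦substᶠ⟧ σ e (∃̇ φ)      = ∃-⇔ λ a → ⟦substᶠ⟧ (lift-subst σ) (eval-lift-subst σ e a) φ

  -- Equivalence with a formula, rather than equality with its interpretation, allows definability
  -- to be derived from any description of a set, one connective at a time.
  record Definable {n p} (P : Pred (Vec Carrier n) p) : Set (c ⊔ ℓ ⊔ f ⊔ r ⊔ p) where
    field
      formula : Formula K n
      correct : ∀ v → P v ⇔ ⟦ formula ⟧ v

  record TermFun {n} (g : Vec Carrier n → Carrier) : Set (c ⊔ f) where
    field
      term    : Term K n
      correct : ∀ v → eval term v ≡ g v

  record TermMap {n k} (g : Vec Carrier n → Vec Carrier k) : Set (c ⊔ f) where
    field
      component : ∀ i → TermFun (λ v → lookup (g v) i)

  open TermMap public

  private
    variable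
      P : Pred (Vec Carrier n) p
      Q : Pred (Vec Carrier n) q
      s t : Vec Carrier n → Carrier
      g h : Vec Carrier n → Vec Carrier k

  Definable-⟦⟧ : (φ : Formula K n) → Definable ⟦ φ ⟧
  Definable-⟦⟧ φ = record { formula = φ ; correct = λ v → mk⇔ id id }

  Definable-resp : (∀ v → Q v ⇔ P v) → Definable P → Definable Q
  Definable-resp e d = record
    { formula = Definable.formula d
    ; correct = λ v → Definable.correct d v ⇔-∘ e v
    }

  TermFun-const : ∀ a → TermFun {n} (λ _ → a)
  TermFun-const a = record { term = const a ; correct = λ _ → refl }

  TermFun-+ : TermFun s → TermFun t → TermFun (λ v → s v + t v)
  TermFun-+ s t = record
    { term    = TermFun.term s ⊕ TermFun.term t
    ; correct = λ v → cong₂ _+_ (TermFun.correct s v) (TermFun.correct t v)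
    }

  TermFun-* : TermFun s → TermFun t → TermFun (λ v → s v * t v)
  TermFun-* s t = record
    { term    = TermFun.term s ⊗ TermFun.term t
    ; correct = λ v → cong₂ _*_ (TermFun.correct s v) (TermFun.correct t v)
    }

  TermFun-neg : TermFun s → TermFun (λ v → - s v)
  TermFun-neg s = record
    { term    = ⊖ TermFun.term s
    ; correct = λ v → cong -_ (TermFun.correct s v)
    }

  TermFun-resp : (∀ v → t v ≡ s v) → TermFun t → TermFun s
  TermFun-resp e t = record
    { term    = TermFun.term t
    ; correct = λ v → trans (TermFun.correct t v) (e v)
    }

  TermMap-id : TermMap {n} id
  TermMap-id = record { component = λ i → record { term = var i ; correct = λ _ → refl } }

  TermMap-const : (a : Vec Carrier k) → TermMap {n} (λ _ → a)
  TermMap-const a = record { component = λ i → TermFun-const (lookup a i) }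

  TermFun-head : TermMap {k = suc k} g → TermFun (λ v → head (g v))
  TermFun-head {g = g} γ = TermFun-resp (λ v → lookup-head (g v)) (component γ zero)
    where
    lookup-head : (a : Vec Carrier (suc k)) → lookup a zero ≡ head a
    lookup-head (x ∷ xs) = refl

  TermMap-tail : TermMap {k = suc k} g → TermMap (λ v → tail (g v))
  TermMap-tail {g = g} γ = record
    { component = λ i → TermFun-resp (λ v → lookup-tail (g v) i) (component γ (suc i)) }
    where
    lookup-tail : (a : Vec Carrier (suc k)) → ∀ i → lookup a (suc i) ≡ lookup (tail a) i
    lookup-tail (x ∷ xs) i = refl

  TermMap-take : ∀ j {k} {g : Vec Carrier n → Vec Carrier (j ℕ.+ k)} →
                 TermMap g → TermMap (λ v → take j (g v))
  TermMap-take j {k} {g} γ = record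
    { component = λ i → TermFun-resp (λ v → sym (lookup-take j (g v) i)) (component γ (i ↑ˡ k)) }

  TermMap-drop : ∀ j {k} {g : Vec Carrier n → Vec Carrier (j ℕ.+ k)} →
                 TermMap g → TermMap (λ v → drop j (g v))
  TermMap-drop j {k} {g} γ = record
    { component = λ i → TermFun-resp (λ v → sym (lookup-drop j (g v) i)) (component γ (j ↑ʳ i)) }

  TermMap-∷ : TermFun s → TermMap g → TermMap (λ v → s v ∷ g v)
  TermMap-∷ σ γ = record { component = λ where
    zero    → σ
    (suc i) → component γ i }

  TermMap-++ : TermMap {k = j} g → TermMap {k = k} h → TermMap (λ v → g v ++ h v)
  TermMap-++ {j = zero} {g = g} γ χ = record
    { component = λ i → TermFun-resp (λ v → cong (λ a → lookup (a ++ _) i) (sym (nil (g v)))) (component χ i) }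
    where
    nil : (a : Vec Carrier 0) → a ≡ []
    nil [] = refl
  TermMap-++ {j = suc j} {g = g} {h = h} γ χ = record
    { component = λ i → TermFun-resp (λ v → cong (λ a → lookup (a ++ h v) i) (η (g v)))
        (component (TermMap-∷ (TermFun-head γ) (TermMap-++ (TermMap-tail γ) χ)) i) }
    where
    η : (a : Vec Carrier (suc j)) → head a ∷ tail a ≡ a
    η (x ∷ xs) = refl

  Definable-∘ : TermMap g → Definable P → Definable (λ v → P (g v))
  Definable-∘ {g = g} γ d = record
    { formula = substᶠ (λ i → TermFun.term (component γ i)) (Definable.formula d)
    ; correct = λ v → mk⇔
        (from (sub v) ∘ to (Definable.correct d (g v)))
        (from (Definable.correct d (g v)) ∘ to (sub v))
    }
    where
    sub : ∀ v → _
    sub v = ⟦substᶠ⟧ _ (λ i → TermFun.correct (component γ i) v) (Definable.formula d)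

  Definable-≡ : TermFun s → TermFun t → Definable (λ v → s v ≡ t v)
  Definable-≡ s t = record
    { formula = TermFun.term s ≈̇ TermFun.term t
    ; correct = λ v → mk⇔
        (lift ∘ subst₂ _≡_ (sym (TermFun.correct s v)) (sym (TermFun.correct t v)))
        (subst₂ _≡_ (TermFun.correct s v) (TermFun.correct t v) ∘ lower)
    }

  Definable-< : TermFun s → TermFun t → Definable (λ v → s v < t v)
  Definable-< s t = record
    { formula = TermFun.term s <̇ TermFun.term t
    ; correct = λ v → mk⇔
        (lift ∘ subst₂ _<_ (sym (TermFun.correct s v)) (sym (TermFun.correct t v)))
        (subst₂ _<_ (TermFun.correct s v) (TermFun.correct t v) ∘ lower)
    }

  Definable-× : Definable P → Definable Q → Definable (λ v → P v × Q v)
  Definable-× d e = record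
    { formula = Definable.formula d ∧̇ Definable.formula e
    ; correct = λ v → Definable.correct d v ×-⇔ Definable.correct e v
    }

  Definable-⊎ : Definable P → Definable Q → Definable (λ v → P v ⊎ Q v)
  Definable-⊎ d e = record
    { formula = Definable.formula d ∨̇ Definable.formula e
    ; correct = λ v → Definable.correct d v ⊎-⇔ Definable.correct e v
    }

  Definable-→ : Definable P → Definable Q → Definable (λ v → P v → Q v)
  Definable-→ d e = record
    { formula = Definable.formula d ⇒̇ Definable.formula e
    ; correct = λ v → →-cong-⇔ (Definable.correct d v) (Definable.correct e v)
    }

  Definable-¬ : Definable P → Definable (λ v → ¬ P v)
  Definable-¬ d = record
    { formula = Definable.formula d ⇒̇ ⊥̇
    ; correct = λ v → mk⇔
        (λ np φ → ⊥-elim (np (from (Definable.correct d v) φ)))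
        (λ np φ → lower (np (to (Definable.correct d v) φ)))
    }

  Definable-≤ : TermFun s → TermFun t → Definable (λ v → s v ≤ t v)
  Definable-≤ s t = Definable-⊎ (Definable-< s t) (Definable-≡ s t)

  Definable-∀₁ : {Q : Carrier → Vec Carrier n → Set q} →
                 Definable (λ w → Q (head w) (tail w)) → Definable (λ v → ∀ a → Q a v)
  Definable-∀₁ d = record
    { formula = ∀̇ Definable.formula d
    ; correct = λ v → ∀-⇔ λ a → Definable.correct d (a ∷ v)
    }

  Definable-∃₁ : {Q : Carrier → Vec Carrier n → Set q} →
                 Definable (λ w → Q (head w) (tail w)) → Definable (λ v → ∃ λ a → Q a v)
  Definable-∃₁ d = record
    { formula = ∃̇ Definable.formula d
    ; correct = λ v → ∃-⇔ λ a → Definable.correct d (a ∷ v)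
    }

  -- The first argument occupies the leading coordinates, so that quantifying over it binds the
  -- lowest variable indices.
  Definable₂ : (Vec Carrier k → Vec Carrier n → Set q) → Set (c ⊔ ℓ ⊔ f ⊔ r ⊔ q)
  Definable₂ {k = k} Q = Definable (λ w → Q (take k w) (drop k w))

  Definable-∀ : {Q : Vec Carrier k → Vec Carrier n → Set q} →
                Definable₂ Q → Definable (λ v → ∀ y → Q y v)
  Definable-∀ {k = zero}  d = Definable-resp (λ v → mk⇔ (λ h → h []) (λ { h [] → h })) d
  Definable-∀ {k = suc k} {Q = Q} d = Definable-resp
    (λ v → mk⇔ (λ h y a → h (a ∷ y)) (λ { h (a ∷ y) → h y a }))
    -- The leading coordinate has index 0 and is therefore bound by the innermost quantifier;
    -- induction binds the others.
    (Definable-∀ {Q = λ y v → ∀ a → Q (a ∷ y) v} (Definable-∀₁ (Definable-resp (λ { (a ∷ w) → mk⇔ id id }) d)))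

  Definable-∃ : {Q : Vec Carrier k → Vec Carrier n → Set q} →
                Definable₂ Q → Definable (λ v → ∃ λ y → Q y v)
  Definable-∃ {k = zero}  d = Definable-resp (λ v → mk⇔ (λ { ([] , h) → h }) ([] ,_)) d
  Definable-∃ {k = suc k} {Q = Q} d = Definable-resp
    (λ v → mk⇔ (λ { (a ∷ y , h) → y , a , h }) (λ (y , a , h) → a ∷ y , h))
    (Definable-∃ {Q = λ y v → ∃ λ a → Q (a ∷ y) v} (Definable-∃₁ (Definable-resp (λ { (a ∷ w) → mk⇔ id id }) d)))

  Definable₂-∘ : {Q : Vec Carrier j → Vec Carrier k → Set q} → Definable₂ Q →
                 TermMap g → TermMap h → Definable (λ v → Q (g v) (h v))
  Definable₂-∘ {g = g} {h = h} {Q = Q} d γ χ = Definable-resp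
    (λ v → ≡⇒⇔ (sym (cong₂ Q (take-++ (g v) (h v)) (drop-++ (g v) (h v)))))
    (Definable-∘ (TermMap-++ γ χ) d)

  -- `R` may depend on `v`, so that a variable such as the radius in `Near` can occur in the
  -- relation.
  Definable-Pointwise : {R : Vec Carrier n → Carrier → Carrier → Set p} →
    (∀ {s t} → TermFun s → TermFun t → Definable (λ v → R v (s v) (t v))) →
    {g h : Vec Carrier n → Vec Carrier k} →
    TermMap g → TermMap h → Definable (λ v → Pointwise (R v) (g v) (h v))
  Definable-Pointwise {k = zero} d {g} {h} γ χ = Definable-resp
    -- The language has no symbol for truth; `⊥̇ ⇒̇ ⊥̇` replaces it.
    (λ v → mk⇔ (λ _ → id) (λ _ → nil (g v) (h v))) (Definable-⟦⟧ (⊥̇ ⇒̇ ⊥̇))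
    where
    nil : ∀ {R : Carrier → Carrier → Set p} (a b : Vec Carrier 0) → Pointwise R a b
    nil [] [] = []
  Definable-Pointwise {k = suc k} d {g} {h} γ χ = Definable-resp
    (λ v → cons (g v) (h v))
    (Definable-× (d (TermFun-head γ) (TermFun-head χ))
                 (Definable-Pointwise d (TermMap-tail γ) (TermMap-tail χ)))
    where
    cons : ∀ {R : Carrier → Carrier → Set p} (a b : Vec Carrier (suc k)) →
           Pointwise R a b ⇔ (R (head a) (head b) × Pointwise R (tail a) (tail b))
    cons (x ∷ xs) (y ∷ ys) = mk⇔ Pointwise.uncons (uncurry _∷_)

  Definable-All : {R : Vec Carrier n → Carrier → Set p} →
    (∀ {s} → TermFun s → Definable (λ v → R v (s v))) →
    {g : Vec Carrier n → Vec Carrier k} → TermMap g → Definable (λ v → All (R v) (g v))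
  Definable-All {k = zero} d {g} γ = Definable-resp
    (λ v → mk⇔ (λ _ → id) (λ _ → nil (g v))) (Definable-⟦⟧ (⊥̇ ⇒̇ ⊥̇))
    where
    nil : ∀ {R : Carrier → Set p} (a : Vec Carrier 0) → All R a
    nil [] = []
  Definable-All {k = suc k} d {g} γ = Definable-resp
    (λ v → cons (g v))
    (Definable-× (d (TermFun-head γ)) (Definable-All d (TermMap-tail γ)))
    where
    cons : ∀ {R : Carrier → Set p} (a : Vec Carrier (suc k)) →
           All R a ⇔ (R (head a) × All R (tail a))
    cons (x ∷ xs) = mk⇔ All.uncons (uncurry _∷_)

-- Arithmetic in an ordered field.

module OrderedFieldProperties {c ℓ} (F : OrderedField c ℓ) where
  open OrderedField F
  open IsCommutativeRing isCommutativeRing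
    using (+-assoc; +-comm; +-identityˡ; +-identityʳ; -‿inverseˡ; -‿inverseʳ;
           *-comm; *-identityʳ; *-identityˡ; distribˡ; distribʳ; isRing; zeroʳ)
  open IsStrictTotalOrder isStrictTotalOrder
    using (compare; irrefl; isEquivalence; <-resp-≈; <-respˡ-≈; <-respʳ-≈)
    renaming (trans to <-trans) public

  ring : Ring c c
  ring = record { isRing = isRing }

  open RingProperties ring using (-‿distribˡ-*; -‿involutive)

  ≤-refl : ∀ {x} → x ≤ x
  ≤-refl = inj₂ refl

  ≤-trans : ∀ {x y z} → x ≤ y → y ≤ z → x ≤ z
  ≤-trans = ToNonStrict.trans _≡_ _<_ isEquivalence <-resp-≈ <-trans

  <-≤-trans : ∀ {x y z} → x < y → y ≤ z → x < z
  <-≤-trans = ToNonStrict.<-≤-trans _≡_ _<_ <-trans <-respʳ-≈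

  ≤-<-trans : ∀ {x y z} → x ≤ y → y < z → x < z
  ≤-<-trans = ToNonStrict.≤-<-trans _≡_ _<_ sym <-trans <-respˡ-≈

  ≤-total : ∀ x y → x ≤ y ⊎ y ≤ x
  ≤-total = ToNonStrict.total _≡_ _<_ compare

  <-≤-total : ∀ x y → x < y ⊎ y ≤ x
  <-≤-total x y with compare x y
  ... | tri< x<y _ _ = inj₁ x<y
  ... | tri≈ _ x≡y _ = inj₂ (inj₂ (sym x≡y))
  ... | tri> _ _ y<x = inj₂ (inj₁ y<x)

  ≤⇒≯ : ∀ {x y} → x ≤ y → ¬ (y < x)
  ≤⇒≯ x≤y y<x = irrefl refl (≤-<-trans x≤y y<x)

  +-monoʳ-< : ∀ z {x y} → x < y → z + x < z + y
  +-monoʳ-< z x<y = subst₂ _<_ (+-comm _ z) (+-comm _ z) (+-monoˡ-< z x<y)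

  +-monoˡ-≤ : ∀ z {x y} → x ≤ y → x + z ≤ y + z
  +-monoˡ-≤ z (inj₁ x<y)  = inj₁ (+-monoˡ-< z x<y)
  +-monoˡ-≤ z (inj₂ refl) = ≤-refl

  +-monoʳ-≤ : ∀ z {x y} → x ≤ y → z + x ≤ z + y
  +-monoʳ-≤ z (inj₁ x<y)  = inj₁ (+-monoʳ-< z x<y)
  +-monoʳ-≤ z (inj₂ refl) = ≤-refl

  x<x+ε : ∀ x {ε} → 0# < ε → x < x + ε
  x<x+ε x {ε} 0<ε = subst (_< x + ε) (+-identityʳ x) (+-monoʳ-< x 0<ε)

  x+y-y≡x : ∀ x y → (x + y) + - y ≡ x
  x+y-y≡x x y = trans (+-assoc x y (- y)) (trans (cong (x +_) (-‿inverseʳ y)) (+-identityʳ x))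

  x-y+y≡x : ∀ x y → (x + - y) + y ≡ x
  x-y+y≡x x y = trans (+-assoc x (- y) y) (trans (cong (x +_) (-‿inverseˡ y)) (+-identityʳ x))

  x+y≤z⇒x≤z-y : ∀ {x y z} → x + y ≤ z → x ≤ z + - y
  x+y≤z⇒x≤z-y {x} {y} h = subst (_≤ _) (x+y-y≡x x y) (+-monoˡ-≤ (- y) h)

  0<y-x : ∀ {x y} → x < y → 0# < y + - x
  0<y-x {x} x<y = subst (_< _) (-‿inverseʳ x) (+-monoˡ-< (- x) x<y)

  x+[y-x]≡y : ∀ x y → x + (y + - x) ≡ y
  x+[y-x]≡y x y = trans (+-comm x _) (x-y+y≡x y x)

  neg-antimono-< : ∀ {x y} → x < y → - y < - x
  neg-antimono-< {x} {y} x<y = subst₂ _<_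
    (trans (cong (x +_) (+-comm (- x) (- y))) (lemma x (- y) (- x) (-‿inverseʳ x)))
    (lemma y (- x) (- y) (-‿inverseʳ y))
    (+-monoˡ-< (- x + - y) x<y)
    where
    open ≡-Reasoning
    lemma : ∀ a b a⁻ → a + a⁻ ≡ 0# → a + (b + a⁻) ≡ b
    lemma a b a⁻ e = begin
      a + (b + a⁻) ≡⟨ cong (a +_) (+-comm b a⁻) ⟩
      a + (a⁻ + b) ≡⟨ +-assoc a a⁻ b ⟨
      (a + a⁻) + b ≡⟨ cong (_+ b) e ⟩
      0# + b       ≡⟨ +-identityˡ b ⟩
      b            ∎

  neg-antimono-≤ : ∀ {x y} → x ≤ y → - y ≤ - x
  neg-antimono-≤ (inj₁ x<y)  = inj₁ (neg-antimono-< x<y)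
  neg-antimono-≤ (inj₂ refl) = ≤-refl

  *-monoʳ-< : ∀ {z} → 0# < z → ∀ {x y} → x < y → z * x < z * y
  *-monoʳ-< {z} 0<z {x} {y} x<y = subst₂ _<_ (+-identityˡ (z * x)) eq
    (+-monoˡ-< (z * x) (*-positive 0<z (0<y-x x<y)))
    where
    eq : z * (y + - x) + z * x ≡ z * y
    eq = trans (sym (distribˡ z (y + - x) x)) (cong (z *_) (x-y+y≡x y x))

  *-monoʳ-≤ : ∀ {z} → 0# < z → ∀ {x y} → x ≤ y → z * x ≤ z * y
  *-monoʳ-≤ 0<z (inj₁ x<y)  = inj₁ (*-monoʳ-< 0<z x<y)
  *-monoʳ-≤ 0<z (inj₂ refl) = ≤-refl

  *-cancelʳ-≤ : ∀ {z} → 0# < z → ∀ {x y} → x * z ≤ y * z → x ≤ y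
  *-cancelʳ-≤ {z} 0<z {x} {y} h with <-≤-total y x
  ... | inj₁ y<x = ⊥-elim (≤⇒≯ h (subst₂ _<_ (*-comm z y) (*-comm z x) (*-monoʳ-< 0<z y<x)))
  ... | inj₂ x≤y = x≤y

  -- In the case 1 < 0 the element -1 is positive, and hence so is its square, which is 1.
  0<1 : 0# < 1#
  0<1 with compare 0# 1#
  ... | tri< 0<1 _ _ = 0<1
  ... | tri≈ _ 0≡1 _ = ⊥-elim (0≢1 0≡1)
  ... | tri> _ _ 1<0 = subst (0# <_) -1*-1≡1 (*-positive 0<-1 0<-1)
    where
    0<-1 : 0# < - 1#
    0<-1 = subst (0# <_) (+-identityˡ (- 1#)) (0<y-x 1<0)

    -1*-1≡1 : - 1# * - 1# ≡ 1#
    -1*-1≡1 = trans (sym (-‿distribˡ-* 1# (- 1#))) (trans (cong -_ (*-identityˡ (- 1#))) (-‿involutive 1#))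

  *-positive⁻ : ∀ {x y} → 0# < x → 0# < x * y → 0# < y
  *-positive⁻ {x} {y} 0<x 0<xy with <-≤-total 0# y
  ... | inj₁ 0<y = 0<y
  ... | inj₂ y≤0 = ⊥-elim (≤⇒≯ (subst (x * y ≤_) (zeroʳ x) (*-monoʳ-≤ 0<x y≤0)) 0<xy)

  positive-inverse : ∀ {x} → 0# < x → ∃ λ y → 0# < y × x * y ≡ 1#
  positive-inverse {x} 0<x =
    let y , xy≡1 = inverse x (λ { refl → irrefl refl 0<x })
    in  y , *-positive⁻ 0<x (subst (0# <_) (sym xy≡1) 0<1) , xy≡1

  -- Halving works: `½` is the inverse of 1 + 1, which is positive, so `ε * ½` is positive and twice
  -- it is `ε`.
  below-positive : ∀ {ε} → 0# < ε → ∃ λ δ → 0# < δ × δ < ε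
  below-positive {ε} 0<ε =
    let ½ , 0<½ , 2½≡1 = positive-inverse (<-trans 0<1 (x<x+ε 1# 0<1))
        δ              = ε * ½
        0<δ            = *-positive 0<ε 0<½
        δ+δ≡ε : δ + δ ≡ ε
        δ+δ≡ε = trans (sym (distribˡ ε ½ ½)) (trans
          (cong (ε *_) (trans (cong₂ _+_ (sym (*-identityˡ ½)) (sym (*-identityˡ ½)))
                       (trans (sym (distribʳ ½ 1# 1#)) 2½≡1)))
          (*-identityʳ ε))
    in  δ , 0<δ , subst (δ <_) δ+δ≡ε (x<x+ε δ 0<δ)

  upper-bound : ∀ x y → ∃ λ z → x ≤ z × y ≤ z
  upper-bound x y with ≤-total x y
  ... | inj₁ x≤y = y , x≤y , ≤-refl
  ... | inj₂ y≤x = x , ≤-refl , y≤x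

  upper-bound-< : ∀ {x y z} → x < z → y < z → ∃ λ w → x ≤ w × y ≤ w × w < z
  upper-bound-< {x} {y} x<z y<z with ≤-total x y
  ... | inj₁ x≤y = y , x≤y , ≤-refl , y<z
  ... | inj₂ y≤x = x , ≤-refl , y≤x , x<z

  lower-bound-< : ∀ {x y z} → z < x → z < y → ∃ λ w → w ≤ x × w ≤ y × z < w
  lower-bound-< {x} {y} z<x z<y with ≤-total x y
  ... | inj₁ x≤y = x , ≤-refl , x≤y , z<x
  ... | inj₂ y≤x = y , y≤x , ≤-refl , z<y

  +-cancelʳ-< : ∀ z {x y} → x + z < y + z → x < y
  +-cancelʳ-< z h = subst₂ _<_ (x+y-y≡x _ z) (x+y-y≡x _ z) (+-monoˡ-< (- z) h)

  -x≤y⇒-y≤x : ∀ {x y} → - x ≤ y → - y ≤ x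
  -x≤y⇒-y≤x {x} {y} h = subst (- y ≤_) (-‿involutive x) (neg-antimono-≤ h)

-- Closure points, somewhere dense sets and their definability.

module Topology {c ℓ f r} (K : Expansion c ℓ f r) where
  open Expansion K
  open OrderedFieldProperties orderedField
  open Definability K

  Adherent : Pred (Vec Carrier n) p → Pred (Vec Carrier n) (c ⊔ ℓ ⊔ p)
  Adherent X z = ∀ a b → Box K a b z → ∃ λ x → Box K a b x × X x

  -- The point `z` certifies that the box is nonempty. Failure of this property is nowhere density
  -- in the whole space, by `nowhereDense⁻` and `nowhereDense⁺`.
  SomewhereDense : Pred (Vec Carrier n) p → Set (c ⊔ ℓ ⊔ p)
  SomewhereDense X = ∃ λ z → ∃₂ λ a b → Box K a b z × (∀ x → Box K a b x → Adherent X x)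

  nowhereDense⁻ : {X : Pred (Vec Carrier n) p} → NowhereDenseIn K U X → ¬ SomewhereDense X
  nowhereDense⁻ nd (z , a , b , z∈ , dense) =
    nd z (tt , a , b , z∈ , λ {x} (x∈ , _) → tt , λ a′ b′ x∈′ →
      let y , y∈ , Xy = dense x x∈ a′ b′ x∈′ in y , y∈ , tt , Xy)

  nowhereDense⁺ : {X : Pred (Vec Carrier n) p} → ¬ SomewhereDense X → NowhereDenseIn K U X
  nowhereDense⁺ nsd z (_ , a , b , z∈ , dense) =
    nsd (z , a , b , z∈ , λ x x∈ a′ b′ x∈′ →
      let y , y∈ , _ , Xy = proj₂ (dense (x∈ , tt)) a′ b′ x∈′ in y , y∈ , Xy)

  Adherent-mono : {X : Pred (Vec Carrier n) p} {Y : Pred (Vec Carrier n) q} →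
                  X ⊆ Y → Adherent X ⊆ Adherent Y
  Adherent-mono X⊆Y adherent a b z∈ = let y , y∈ , Xy = adherent a b z∈ in y , y∈ , X⊆Y Xy

  SomewhereDense-mono : {X : Pred (Vec Carrier n) p} {Y : Pred (Vec Carrier n) q} →
                        X ⊆ Y → SomewhereDense X → SomewhereDense Y
  SomewhereDense-mono X⊆Y (z , a , b , z∈ , dense) =
    z , a , b , z∈ , λ x x∈ → Adherent-mono X⊆Y (dense x x∈)

  SomewhereDense⇒∃ : {X : Pred (Vec Carrier n) p} → SomewhereDense X → ∃ X
  SomewhereDense⇒∃ (z , a , b , z∈ , dense) = let x , _ , Xx = dense z z∈ a b z∈ in x , Xx

  -- In each coordinate the larger of the lower ends and the smaller of the upper ends serve.
  Box-∩ : ∀ {a b a′ b′ z : Vec Carrier n} → Box K a b z → Box K a′ b′ z →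
          ∃₂ λ a″ b″ → Box K a″ b″ z × Box K a″ b″ ⊆ Box K a b × Box K a″ b″ ⊆ Box K a′ b′
  Box-∩ ([] , []) ([] , []) = [] , [] , ([] , []) , id , id
  Box-∩ {a = a ∷ _} {b ∷ _} {a′ ∷ _} {b′ ∷ _} (l ∷ ls , u ∷ us) (l′ ∷ ls′ , u′ ∷ us′) =
    let as″ , bs″ , (ls″ , us″) , ⊆₁ , ⊆₂ = Box-∩ (ls , us) (ls′ , us′)
        a″ , a≤ , a′≤ , l″ = upper-bound-< l l′
        b″ , ≤b , ≤b′ , u″ = lower-bound-< u u′
    in  a″ ∷ as″ , b″ ∷ bs″ , (l″ ∷ ls″ , u″ ∷ us″)
      , (λ { (p ∷ ps , q ∷ qs) → let ps′ , qs′ = ⊆₁ (ps , qs) in ≤-<-trans a≤ p ∷ ps′ , <-≤-trans q ≤b ∷ qs′ })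
      , (λ { (p ∷ ps , q ∷ qs) → let ps′ , qs′ = ⊆₂ (ps , qs) in ≤-<-trans a′≤ p ∷ ps′ , <-≤-trans q ≤b′ ∷ qs′ })

  Definable-Box : {a b z : Vec Carrier n → Vec Carrier k} →
                  TermMap a → TermMap b → TermMap z → Definable (λ v → Box K (a v) (b v) (z v))
  Definable-Box a b z =
    Definable-× (Definable-Pointwise {R = λ _ → _<_} Definable-< a z)
                (Definable-Pointwise {R = λ _ → _<_} Definable-< z b)

  Definable-Adherent : {X : Vec Carrier k → Vec Carrier n → Set p} {g : Vec Carrier n → Vec Carrier k} →
                       Definable₂ X → TermMap g → Definable (λ v → Adherent (λ x → X x v) (g v))
  Definable-Adherent {k = k} {n = n} {X = X} {g = g} d γ = Definable₂-∘ {Q = λ y v → Adherent (λ x → X x v) y}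
    (Definable-∀ (Definable-∀ (Definable-→
      -- The variables are `b`, `a`, the point and `v`, in this order; below the existential
      -- quantifier its witness stands in front of them.
      (Definable-Box (TermMap-take k (TermMap-drop k TermMap-id))
                     (TermMap-take k TermMap-id)
                     (TermMap-take k (TermMap-drop k (TermMap-drop k TermMap-id))))
      (Definable-∃ (Definable-×
        (Definable-Box (TermMap-take k (TermMap-drop k (TermMap-drop k TermMap-id)))
                       (TermMap-take k (TermMap-drop k TermMap-id))
                       (TermMap-take k TermMap-id))
        (Definable₂-∘ {Q = X} d (TermMap-take k TermMap-id)
          (TermMap-drop k (TermMap-drop k (TermMap-drop k (TermMap-drop k TermMap-id))))))))))
    γ TermMap-id

  -- Boxes are given by their corners, so density is a first-order condition on the parameter `v`.
  -- `pigeonhole₁` relies on this to apply completeness to a set of parameters.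
  Definable-SomewhereDense : {X : Vec Carrier k → Vec Carrier n → Set p} →
                             Definable₂ X → Definable (λ v → SomewhereDense (λ x → X x v))
  Definable-SomewhereDense {k = k} {X = X} d =
    Definable-∃ (Definable-∃ (Definable-∃ (Definable-×
      (Definable-Box (TermMap-take k (TermMap-drop k TermMap-id))
                     (TermMap-take k TermMap-id)
                     (TermMap-take k (TermMap-drop k (TermMap-drop k TermMap-id))))
      (Definable-∀ (Definable-→
        (Definable-Box (TermMap-take k (TermMap-drop k (TermMap-drop k TermMap-id)))
                       (TermMap-take k (TermMap-drop k TermMap-id))
                       (TermMap-take k TermMap-id))
        (Definable-Adherent {X = λ x w → X x (drop k (drop k (drop k (drop k w))))}
          (Definable₂-∘ {Q = X} d (TermMap-take k TermMap-id)
            (TermMap-drop k (TermMap-drop k (TermMap-drop k (TermMap-drop k (TermMap-drop k TermMap-id))))))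
          (TermMap-take k TermMap-id)))))))

  module _ (em : Classical) where

    -- If `X` misses some box around a point of the given box, then `Y` is dense in a box contained
    -- in both; if `X` misses none, it is dense in the given box itself.
    SomewhereDense-∪ : {X : Pred (Vec Carrier n) p} {Y : Pred (Vec Carrier n) q} →
                       SomewhereDense (X ∪ Y) → SomewhereDense X ⊎ SomewhereDense Y
    SomewhereDense-∪ {n = n} {p = p} {X = X} {Y = Y} (z , a , b , z∈ , dense) with em {P = SomewhereDense X}
    ... | yes X-dense = inj₁ X-dense
    ... | no ¬X-dense = inj₂ (em⇒dne em λ ¬Y-dense →
      ¬X-dense (z , a , b , z∈ , λ x x∈ a′ b′ x∈′ → em⇒dne em λ X-avoids →
        let a″ , b″ , x∈″ , ⊆₁ , ⊆₂ = Box-∩ x∈ x∈′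
        in  ¬Y-dense (x , a″ , b″ , x∈″ , λ y y∈ a‴ b‴ y∈‴ →
              let _ , _ , y∈⁗ , ⊆₃ , ⊆₄ = Box-∩ y∈ y∈‴
                  w , w∈ , XYw = dense y (⊆₁ y∈) _ _ y∈⁗
              in  w , ⊆₄ w∈ , [ (λ Xw → ⊥-elim (X-avoids (w , ⊆₂ (⊆₃ w∈) , Xw))) , id ]′ XYw)))

module KuratowskiUlam (em : Classical) {c ℓ f r} (K : Expansion c ℓ f r)
                      (complete : DefinablyComplete K) where
  open Expansion K
  open IsCommutativeRing isCommutativeRing using (*-comm)
  open OrderedFieldProperties orderedField
  open Definability K
  open Topology K
  open AddExtrema _≤_ using (_≤±_) renaming ([_] to [_]≤)

  -- Suprema and the pigeonhole principle.

  supremum : {P : Pred Carrier p} → Definable (λ v → P (head v)) → ∃ P →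
             (∃ λ u → ∀ x → P x → x ≤ u) →
             ∃ λ s → (∀ x → P x → x ≤ s) × (∀ u → (∀ x → P x → x ≤ u) → s ≤ u)
  supremum {P = P} d (x₀ , Px₀) (u₀ , u₀-bound) with complete (Definable.formula d)
  -- The element `x₀` excludes the supremum -∞; in the last case the bound `u₀` excludes +∞.
  ... | ⊥± , bound , _ = case bound x₀ (to (Definable.correct d _) Px₀) of λ { AddSupremum.[ () ] }
  ... | [ s ] , bound , least =
    s , (λ x Px → lower≤ (bound x (to (Definable.correct d _) Px)))
      , (λ u u-bound → lower≤ (least [ u ] λ x φx → [ u-bound x (from (Definable.correct d _) φx) ]≤))
    where
    lower≤ : ∀ {x y} → [ x ] ≤± [ y ] → x ≤ y
    lower≤ [ x≤y ]≤ = x≤y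
  ... | ⊤± , _ , least = case least [ u₀ ] (λ x φx → [ u₀-bound x (from (Definable.correct d _) φx) ]≤) of λ ()

  -- If `P` were closed under adding `ε`, its supremum minus `ε` would still be an upper bound. This
  -- does the work of the Archimedean property, which `K` need not have.
  last-step : {P : Pred Carrier p} → Definable (λ v → P (head v)) → ∃ P →
              (∃ λ u → ∀ x → P x → x ≤ u) → ∀ {ε} → 0# < ε → ∃ λ s → P s × ¬ P (s + ε)
  last-step {P = P} d Px₀ bounded {ε} 0<ε = em⇒dne em λ none →
    let s , s-bound , s-least = supremum d Px₀ bounded
        s≤s-ε = s-least (s + - ε) λ x Px →
          x+y≤z⇒x≤z-y (s-bound (x + ε) (em⇒dne em λ ¬Px+ε → none (x , Px , ¬Px+ε)))
    in  ≤⇒≯ s≤s-ε (subst (s + - ε <_) (x-y+y≡x s ε) (x<x+ε (s + - ε) 0<ε))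

  -- At a last step `s`, the points with a value below `s` are nowhere dense and those with a value
  -- below `s + ε` are not. The former can be removed by `SomewhereDense-∪`, which leaves the points
  -- with a value in [s, s + ε).
  pigeonhole₁ : ∀ {m} {R : Carrier → Vec Carrier m → Set p} → Definable (λ w → R (head w) (tail w)) →
                ∀ {l u} → (∀ {y x} → R y x → l ≤ y × y ≤ u) →
                ∀ {ε} → 0# < ε → SomewhereDense (λ x → ∃ λ y → R y x) →
                ∃ λ c → SomewhereDense (λ x → ∃ λ y → (c ≤ y × y < c + ε) × R y x)
  pigeonhole₁ {m = m} {R = R} d {l} {u} bounds {ε} 0<ε dense =
    let s , sparse , ¬sparse = last-step definable (l , nonempty) (u , bounded) 0<ε
        split : ∀ {x} → (∃ λ y → y < s + ε × R y x) → _ ⊎ _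
        split (y , y<s+ε , Ryx) = Sum.map
          (λ y<s → y , y<s , Ryx) (λ s≤y → y , (s≤y , y<s+ε) , Ryx) (<-≤-total y s)
    in  s , [ (λ below → ⊥-elim (sparse below)) , id ]′
              (SomewhereDense-∪ em (SomewhereDense-mono split (em⇒dne em ¬sparse)))
    where
    Sparse : Carrier → Set _
    Sparse s = ¬ SomewhereDense (λ x → ∃ λ y → y < s × R y x)

    definable : Definable (λ v → Sparse (head v))
    definable = Definable-¬ (Definable-SomewhereDense {X = λ x v → ∃ λ y → y < head v × R y x}
      (Definable-∃₁ (Definable-×
        (Definable-< (TermFun-head TermMap-id) (TermFun-head (TermMap-drop m (TermMap-tail TermMap-id))))
        (Definable-∘ (TermMap-∷ (TermFun-head TermMap-id) (TermMap-take m (TermMap-tail TermMap-id))) d))))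

    nonempty : Sparse l
    -- No value lies below `l`, so the set is empty, while a somewhere dense set has an element.
    nonempty dense′ =
      let _ , y , y<l , Ryx = SomewhereDense⇒∃ dense′ in ≤⇒≯ (proj₁ (bounds Ryx)) y<l

    -- Beyond `u` the restriction `y < s` always holds, and without it the set is somewhere dense by
    -- hypothesis.
    bounded : ∀ s → Sparse s → s ≤ u
    bounded s sparse with <-≤-total u s
    ... | inj₁ u<s = ⊥-elim (sparse (SomewhereDense-mono
                       (λ (y , Ryx) → y , ≤-<-trans (proj₂ (bounds Ryx)) u<s , Ryx) dense))
    ... | inj₂ s≤u = s≤u

  -- The first coordinate is confined by `pigeonhole₁` while the others are quantified away; the
  -- confined coordinate is then quantified away and the induction treats the others.
  pigeonhole : ∀ {m} {Z : Vec Carrier k → Vec Carrier m → Set p} → Definable₂ Z →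
               ∀ {l u ε} → 0# < ε →
               SomewhereDense (λ x → ∃ λ y → All (λ a → l ≤ a × a ≤ u) y × Z y x) →
               ∃ λ (cs : Vec Carrier k) → SomewhereDense (λ x → ∃ λ y → Pointwise (λ c a → c ≤ a × a < c + ε) cs y × Z y x)
  pigeonhole {k = zero} d 0<ε dense =
    [] , SomewhereDense-mono (λ { ([] , [] , Zx) → [] , [] , Zx }) dense
  pigeonhole {k = suc k} {m = m} {Z = Z} d {l} {u} {ε} 0<ε dense =
    let c₁ , dense₁ = pigeonhole₁ {R = R} R-definable {l} {u} proj₁ 0<ε
          (SomewhereDense-mono (λ { (a ∷ y , (b ∷ bs) , Zx) → a , b , y , bs , Zx }) dense)
        cs , denseₛ = pigeonhole {Z = Z′ c₁} (Z′-definable c₁) {l} {u} 0<ε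
          (SomewhereDense-mono (λ (a , close , b , y , bs , Zx) → y , bs , a , close , Zx) dense₁)
    in  c₁ ∷ cs , SomewhereDense-mono
          (λ (y , closes , a , close , Zx) → a ∷ y , close ∷ closes , Zx) denseₛ
    where
    -- The bounds on the remaining coordinates are carried along, since the recursive call requires
    -- them.
    R : Carrier → Vec Carrier m → Set _
    R a x = (l ≤ a × a ≤ u) × ∃ λ y → All (λ a → l ≤ a × a ≤ u) y × Z (a ∷ y) x

    between : ∀ {n} {t : Vec Carrier n → Carrier} → TermFun t → Definable (λ v → l ≤ t v × t v ≤ u)
    between t = Definable-× (Definable-≤ (TermFun-const l) t) (Definable-≤ t (TermFun-const u))

    R-definable : Definable (λ w → R (head w) (tail w))
    R-definable = Definable-× (between (TermFun-head TermMap-id))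
      (Definable-∃ (Definable-×
        (Definable-All {R = λ _ a → l ≤ a × a ≤ u} between (TermMap-take k TermMap-id))
        (Definable₂-∘ {Q = Z} d
          (TermMap-∷ (TermFun-head (TermMap-drop k TermMap-id)) (TermMap-take k TermMap-id))
          (TermMap-tail (TermMap-drop k TermMap-id)))))

    -- Binding the confined first coordinate leaves a relation on `k` coordinates, to which the
    -- induction hypothesis applies.
    Z′ : Carrier → Vec Carrier k → Vec Carrier m → Set _
    Z′ c y x = ∃ λ a → (c ≤ a × a < c + ε) × Z (a ∷ y) x

    Z′-definable : ∀ c → Definable₂ (Z′ c)
    Z′-definable c = Definable-∃₁ (Definable-×
      (Definable-× (Definable-≤ (TermFun-const c) (TermFun-head TermMap-id))
                   (Definable-< (TermFun-head TermMap-id) (TermFun-const (c + ε))))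
      (Definable₂-∘ {Q = Z} d
        (TermMap-∷ (TermFun-head TermMap-id) (TermMap-take k (TermMap-tail TermMap-id)))
        (TermMap-drop k (TermMap-tail TermMap-id))))

  -- Boxes, and open balls of the maximum norm written without absolute values.

  Near : Carrier → Vec Carrier n → Vec Carrier n → Set (c ⊔ ℓ)
  Near h = Pointwise (λ a b → a < b + h × b < a + h)

  Definable-Near : {h : Vec Carrier k → Carrier} {z w : Vec Carrier k → Vec Carrier n} →
                   TermFun h → TermMap z → TermMap w → Definable (λ v → Near (h v) (z v) (w v))
  Definable-Near {h = h} η = Definable-Pointwise {R = λ v a b → a < b + h v × b < a + h v}
    λ a b → Definable-× (Definable-< a (TermFun-+ b η)) (Definable-< b (TermFun-+ a η))

  Near-mono : ∀ {h h′} → h ≤ h′ → {z w : Vec Carrier n} → Near h z w → Near h′ z w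
  Near-mono h≤h′ = Pointwise.map λ (p , q) →
    <-≤-trans p (+-monoʳ-≤ _ h≤h′) , <-≤-trans q (+-monoʳ-≤ _ h≤h′)

  -- The radius is the least of 1 and the distances from `z` to the faces of the box.
  Box⇒Near : {a b z : Vec Carrier n} → Box K a b z →
             ∃ λ h → 0# < h × (∀ {w} → Near h z w → Box K a b w)
  Box⇒Near ([] , []) = 1# , 0<1 , λ { [] → [] , [] }
  Box⇒Near {a = a ∷ _} {b = b ∷ _} {z = z ∷ _} (a<z ∷ ls , z<b ∷ us) =
    let h₀ , 0<h₀ , near = Box⇒Near (ls , us)
        h₁ , h₁≤z-a , h₁≤b-z , 0<h₁ = lower-bound-< (0<y-x a<z) (0<y-x z<b)
        h , h≤h₀ , h≤h₁ , 0<h = lower-bound-< 0<h₀ 0<h₁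
        a+h≤z = subst (a + h ≤_) (x+[y-x]≡y a z) (+-monoʳ-≤ a (≤-trans h≤h₁ h₁≤z-a))
        z+h≤b = subst (z + h ≤_) (x+[y-x]≡y z b) (+-monoʳ-≤ z (≤-trans h≤h₁ h₁≤b-z))
    in  h , 0<h , λ { ((z<w+h , w<z+h) ∷ ps) →
          let ls′ , us′ = near (Near-mono h≤h₀ ps)
          in  +-cancelʳ-< h (≤-<-trans a+h≤z z<w+h) ∷ ls′ , <-≤-trans w<z+h z+h≤b ∷ us′ }

  -- Two points of one cube of side `η`, half-open for `z` and open for `y`, differ by less than `η`
  -- in each coordinate. Hence the balls of radius `η` about all centres in the cube have its
  -- interior in common.
  Box⇒Near-corner : ∀ {η} {cs z y : Vec Carrier n} → Pointwise (λ c a → c ≤ a × a < c + η) cs z →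
                    Box K cs (Vec.map (_+ η) cs) y → Near η z y
  Box⇒Near-corner []       ([] , [])         = []
  Box⇒Near-corner {η = η} ((c≤a , a<c+η) ∷ ps) (c<b ∷ ls , b<c+η ∷ us) =
    (<-trans a<c+η (+-monoˡ-< η c<b) , <-≤-trans b<c+η (+-monoˡ-≤ η c≤a)) ∷ Box⇒Near-corner ps (ls , us)

  Box-++ : ∀ {m} {a b x : Vec Carrier m} {a′ b′ y : Vec Carrier n} →
           Box K a b x → Box K a′ b′ y → Box K (a ++ a′) (b ++ b′) (x ++ y)
  Box-++ (l , u) (l′ , u′) = Pointwise.++⁺ l l′ , Pointwise.++⁺ u u′

  Box-++⁻ : ∀ {m} {a b x : Vec Carrier m} {a′ b′ y : Vec Carrier n} →
            Box K (a ++ a′) (b ++ b′) (x ++ y) → Box K a b x × Box K a′ b′ y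
  Box-++⁻ {a = a} {b} {x} (l , u) =
    let l₁ , l₂ = Pointwise.++⁻ a x l
        u₁ , u₂ = Pointwise.++⁻ x b u
    in  (l₁ , u₁) , (l₂ , u₂)

  -- This exhibits a point of an open cube, as `SomewhereDense` demands.
  Box-translate : ∀ {δ η} → 0# < δ → δ < η → (c : Vec Carrier n) →
                  Box K c (Vec.map (_+ η) c) (Vec.map (_+ δ) c)
  Box-translate 0<δ δ<η []      = [] , []
  Box-translate 0<δ δ<η (c ∷ cs) =
    let ls , us = Box-translate 0<δ δ<η cs
    in  x<x+ε c 0<δ ∷ ls , +-monoʳ-< c δ<η ∷ us

  Bounded : Carrier → Vec Carrier n → Set (c ⊔ ℓ)
  Bounded t = All (λ a → - t ≤ a × a ≤ t)

  Bounded-mono : ∀ {t t′} → t ≤ t′ → {z : Vec Carrier n} → Bounded t z → Bounded t′ z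
  Bounded-mono t≤t′ = All.map λ (p , q) → ≤-trans (neg-antimono-≤ t≤t′) p , ≤-trans q t≤t′

  bounded-by : (z : Vec Carrier n) → ∃ λ t → Bounded t z
  bounded-by []      = 0# , []
  bounded-by (a ∷ z) =
    let t₀ , bs = bounded-by z
        t₁ , -a≤t₁ , a≤t₁ = upper-bound (- a) a
        t , t₀≤t , t₁≤t = upper-bound t₀ t₁
    in  t , (-x≤y⇒-y≤x (≤-trans -a≤t₁ t₁≤t) , ≤-trans a≤t₁ t₁≤t) ∷ Bounded-mono t₀≤t bs

  -- The increasing family `Fat` of points over which the fibre closure contains a large box.

  module _ (m : ℕ) {n : ℕ} (A : Carrier → Pred (Vec Carrier (m ℕ.+ n)) p) where

    AdherentBox : Carrier → Carrier → Vec Carrier n → Pred (Vec Carrier m) (c ⊔ ℓ ⊔ p)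
    AdherentBox t h z x = ∀ w → Near h z w → Adherent (Fibre {m = m} (A t) x) w

    -- The bounds on z and 1/h are tied to the single parameter t, so that Fat is a
    -- family increasing in t; 1 ≤ h * t forces 0 < t.
    Fat : Carrier → Pred (Vec Carrier m) (c ⊔ ℓ ⊔ p)
    Fat t x = ∃ λ z → Bounded t z × ∃ λ h → 0# < h × 1# ≤ h * t × AdherentBox t h z x

    module _ (d : Definable (λ v → A (head v) (tail v))) where

      Definable-AdherentBox : {t h : Vec Carrier k → Carrier}
                              {z : Vec Carrier k → Vec Carrier n} {x : Vec Carrier k → Vec Carrier m} →
                              TermFun t → TermFun h → TermMap z → TermMap x →
                              Definable (λ v → AdherentBox (t v) (h v) (z v) (x v))
      Definable-AdherentBox t h z x = Definable₂-∘
        -- The level, the radius and the base point are packed into the one vector `y`, so that a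
        -- substitution in two arguments suffices.
        {Q = λ z y → AdherentBox (head y) (head (tail y)) z (tail (tail y))}
        (Definable-∀ (Definable-→
          (Definable-Near (TermFun-head (TermMap-tail (TermMap-drop n (TermMap-drop n TermMap-id))))
                          (TermMap-take n (TermMap-drop n TermMap-id))
                          (TermMap-take n TermMap-id))
          (Definable-Adherent
            {X = λ y v → A (head (drop n (drop n v))) (tail (tail (drop n (drop n v))) ++ y)}
            (Definable-∘
              (TermMap-∷ (TermFun-head (TermMap-drop n (TermMap-drop n (TermMap-drop n TermMap-id))))
                         (TermMap-++ (TermMap-tail (TermMap-tail
                                        (TermMap-drop n (TermMap-drop n (TermMap-drop n TermMap-id)))))
                                     (TermMap-take n TermMap-id)))
              d)
            (TermMap-take n TermMap-id))))
        z (TermMap-∷ t (TermMap-∷ h x))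

      Definable-Fat : Definable (λ v → Fat (head v) (tail v))
      Definable-Fat = Definable-∃ (Definable-×
        (Definable-All {R = λ v a → - head (drop n v) ≤ a × a ≤ head (drop n v)}
          (λ a → Definable-× (Definable-≤ (TermFun-neg t) a) (Definable-≤ a t))
          (TermMap-take n TermMap-id))
        (Definable-∃₁ (Definable-×
          (Definable-< (TermFun-const 0#) (TermFun-head TermMap-id))
          (Definable-×
            (Definable-≤ (TermFun-const 1#) (TermFun-* (TermFun-head TermMap-id)
              (TermFun-head (TermMap-drop n (TermMap-tail TermMap-id)))))
            (Definable-AdherentBox
              (TermFun-head (TermMap-drop n (TermMap-tail TermMap-id)))
              (TermFun-head TermMap-id)
              (TermMap-take n (TermMap-tail TermMap-id))
              (TermMap-tail (TermMap-drop n (TermMap-tail TermMap-id))))))))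
        where
        t : TermFun (λ v → head (drop n v))
        t = TermFun-head (TermMap-drop n TermMap-id)

      -- All radii at level `t` are at least 1/t and can be shrunk to this common value. With the
      -- centres confined to one cube, the fibre closures over a somewhere dense set of points share
      -- an open cube, and a box times that cube lies in the closure of `A t`.
      Fat-nowhereDense : ∀ t → ¬ SomewhereDense (A t) → ¬ SomewhereDense (Fat t)
      Fat-nowhereDense t sparse dense =
        -- An element of `Fat t` yields 0 < t, so that 1/t exists and can serve as the side `η` of
        -- the cube.
        let _ , _ , _ , h , 0<h , 1≤ht , _ = SomewhereDense⇒∃ dense
            0<t = *-positive⁻ 0<h (<-≤-trans 0<1 1≤ht)
            η , 0<η , tη≡1 = positive-inverse 0<t
            cs , p , a , b , p∈ , dense′ = pigeonhole {Z = AdherentBox t η}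
              (Definable-AdherentBox (TermFun-const t) (TermFun-const η)
                (TermMap-take n TermMap-id) (TermMap-drop n TermMap-id))
              { - t} {t} 0<η
              (SomewhereDense-mono
                (λ (z , z-bounded , h , _ , 1≤ht , box) → z , z-bounded , λ w near →
                  -- From `η * t = 1 ≤ h * t` follows `η ≤ h`, so the ball of radius `η` lies in
                  -- that of radius `h`.
                  box w (Near-mono (*-cancelʳ-≤ 0<t (subst (_≤ h * t) (trans (sym tη≡1) (*-comm t η)) 1≤ht)) near))
                dense)
            -- Shifting the corner `cs` by `δ` gives a point inside the open cube.
            δ , 0<δ , δ<η = below-positive 0<η
        in  sparse ( p ++ Vec.map (_+ δ) cs , a ++ cs , b ++ Vec.map (_+ η) cs
                   , Box-++ p∈ (Box-translate 0<δ δ<η cs)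
                   , product-adherent λ x x∈ a′ b′ x∈′ →
                       let x′ , x′∈ , z , z-close , box = dense′ x x∈ a′ b′ x∈′
                       in  x′ , x′∈ , λ y y∈ → box y (Box⇒Near-corner z-close y∈))
        where
        -- First `x` is moved to a nearby `x′` whose fibre is dense in the second box; then `y` is
        -- moved to a point of that same fibre.
        product-adherent : ∀ {a b a′ b′} →
          (∀ x → Box K a b x → Adherent (λ x → ∀ y → Box K a′ b′ y → Adherent (Fibre {m = m} (A t) x) y) x) →
          ∀ v → Box K (a ++ a′) (b ++ b′) v → Adherent (A t) v
        product-adherent {a} {b} dense v v∈ a″ b″ v∈″ with splitAt m v | splitAt m a″ | splitAt m b″
        ... | x , y , refl | a₁ , _ , refl | b₁ , _ , refl =
          let x∈ , y∈ = Box-++⁻ {a = a} {b = b} v∈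
              x∈″ , y∈″ = Box-++⁻ {a = a₁} {b = b₁} v∈″
              x′ , x′∈ , adherent = dense x x∈ _ _ x∈″
              y′ , y′∈ , Axy = adherent y y∈ _ _ y∈″
          in  x′ ++ y′ , Box-++ x′∈ y′∈ , Axy

      -- The same centre and radius serve: as `h` is positive, a larger `t` weakens both bounds, and
      -- it enlarges the fibres.
      Fat-increasing : (∀ {t t′} → t ≤ t′ → A t ⊆ A t′) → ∀ {t t′} → t ≤ t′ → Fat t ⊆ Fat t′
      Fat-increasing A-increasing t≤t′ (z , z-bounded , h , 0<h , 1≤ht , box) =
        z , Bounded-mono t≤t′ z-bounded , h , 0<h , ≤-trans 1≤ht (*-monoʳ-≤ 0<h t≤t′) ,
        λ w near → Adherent-mono (A-increasing t≤t′) (box w near)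

      -- The new level exceeds three quantities: the old level `t₀`, a bound `t₁` on the centre, and
      -- the inverse `t₂` of a radius fitting into the box.
      Fat-covers : (∀ {t t′} → t ≤ t′ → A t ⊆ A t′) →
                   ∀ {x t} → SomewhereDense (Fibre {m = m} (A t) x) → ∃ λ t → Fat t x
      Fat-covers A-increasing {t = t₀} (z , a , b , z∈ , dense) =
        let h , 0<h , near⇒box = Box⇒Near z∈
            t₁ , z-bounded = bounded-by z
            t₂ , 0<t₂ , ht₂≡1 = positive-inverse 0<h
            t₃ , t₀≤t₃ , t₁≤t₃ = upper-bound t₀ t₁
            t , t₃≤t , t₂≤t = upper-bound t₃ t₂
        in  t , z , Bounded-mono (≤-trans t₁≤t₃ t₃≤t) z-bounded , h , 0<h ,
            subst (_≤ h * t) ht₂≡1 (*-monoʳ-≤ 0<h t₂≤t) ,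
            λ w near → Adherent-mono (A-increasing (≤-trans t₀≤t₃ t₃≤t)) (dense w (near⇒box near))

  -- Meagerness of the exceptional set.

  definablyMeager : {X : Pred (Vec Carrier n) p} {B : Carrier → Pred (Vec Carrier n) q} →
                    Definable (λ v → B (head v) (tail v)) → (∀ t → ¬ SomewhereDense (B t)) →
                    (∀ {t t′} → t ≤ t′ → B t ⊆ B t′) → (∀ {x} → X x → ∃ λ t → B t x) →
                    DefinablyMeagerIn K U X
  definablyMeager d sparse increasing covers =
      Definable.formula d
    , (λ t → _ , nowhereDense⁺ (sparse t ∘ SomewhereDense-mono (from (Definable.correct d _))))
    , (λ t≤t′ → to (Definable.correct d _) ∘ increasing t≤t′ ∘ from (Definable.correct d _))
    , (λ Xx → let t , Btx = covers Xx in t , to (Definable.correct d _) Btx)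

  kuratowski-ulam : ∀ m n (D : Pred (Vec Carrier (m ℕ.+ n)) p) → DefinablyMeagerIn K U D →
                    DefinablyResidualIn K U (λ x → DefinablyMeagerIn K U (Fibre {m = m} D x))
  kuratowski-ulam m n D (φ , sparse , increasing , covers) =
    definablyMeager (Definable-Fat m A A-definable)
      (λ t → Fat-nowhereDense m A A-definable t (nowhereDense⁻ (proj₂ (sparse t))))
      (Fat-increasing m A A-definable increasing)
      -- A point `x` outside every `Fat t` would lie in the set of points with meager fibre: by
      -- `Fat-covers` the fibres of all `A t` over `x` are nowhere dense, and they increase with `t`
      -- and cover the fibre of `D`.
      (λ {x} (_ , x∉T) → em⇒dne em λ not-fat → x∉T (definablyMeager
        -- The coordinates of `x` enter the formula as parameters.
        (Definable-∘ (TermMap-∷ (TermFun-head TermMap-id) (TermMap-++ (TermMap-const x) (TermMap-tail TermMap-id)))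
                     (Definable-⟦⟧ φ))
        (λ t dense → not-fat (Fat-covers m A A-definable increasing dense))
        (λ t≤t′ → increasing t≤t′)
        covers))
    where
    A : Carrier → Pred (Vec Carrier (m ℕ.+ n)) (c ⊔ ℓ)
    A t v = ⟦ φ ⟧ (t ∷ v)

    A-definable : Definable (λ v → A (head v) (tail v))
    A-definable = Definable-resp (λ { (t ∷ v) → mk⇔ id id }) (Definable-⟦⟧ φ)

open import Data.Nat.Base using (_+_; _≤_)

theorem4p1 :
    Classical →
    ∀ {c ℓ f r d} (K : Expansion c ℓ f r) → DefinablyComplete K →
    ∀ m n → 1 ≤ m → 1 ≤ n →
    (D : Pred (Vec (Expansion.Carrier K) (m + n)) d) →
    let T : Pred (Vec (Expansion.Carrier K) m) _
        T x = DefinablyMeagerIn K U (Fibre {m = m} D x)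
    in DefinablyMeagerIn K U D → DefinablyResidualIn K U T
theorem4p1 em K complete m n _ _ D = KuratowskiUlam.kuratowski-ulam em K complete m n D
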